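{- Let $k\in\mathbb{Z}$, let $n\ge 1$ be an integer, and let $\lambda\in\mathbb{C}$ be nonzero. Then $$\beta_{n,\lambda}^{(k)}=\frac{1}{n+1}\left\{\beta_{n,\lambda}^{(k-1)}-\sum_{m=1}^{n-1}\binom{n}{m-1}\beta_{m,\lambda}^{(k)}\left(\frac{1}{\lambda}\right)_{n-m+1}\lambda^{n-m+1}-\lambda\sum_{m=0}^{n-1}\binom{n}{m}\left(\frac{1}{\lambda}\right)_{n-m}\lambda^{n-m}\,m\,\beta_{m,\lambda}^{(k)}\right\}.$$
   Context: For $k\in\mathbb{Z}$, $\mathrm{Li}_k(u)=\sum_{n=1}^{\infty}\frac{u^n}{n^k}$. For nonzero $\lambda$, the fully degenerate poly-Bernoulli numbers $\beta_{n,\lambda}^{(k)}$ are defined by the generating function (identity of formal power series in $t$) $$\frac{\mathrm{Li}_{k}\left(1-(1+\lambda t)^{ -1/\lambda}\right)}{1-(1+\lambda t)^{ -1/\lambda}}=\sum_{n=0}^{\infty}\beta_{n,\lambda}^{(k)}\frac{t^{n}}{n!},$$ where $(1+\lambda t)^{a}=\sum_{j\ge0}(a)_j\lambda^j\frac{t^j}{j!}$ and $\mathrm{Li}_k(u)/u$ denotes the series $\sum_{m\ge 0}u^m/(m+1)^k$. Here $(a)_j=a(a-1)\cdots(a-j+1)$, $(a)_0=1$, is the falling factorial. Empty sums are zero. -}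

module Defs where

open import Algebra.Apartness.Bundles using (HeytingCommutativeRing; HeytingField)
open import Algebra.Bundles using (CommutativeRing)
open import Algebra.Definitions.RawMonoid using () renaming (_×_ to times)
open import Data.Fin.Base using (toℕ)
open import Data.Integer.Base as ℤ using (ℤ; +_; -[1+_])
open import Data.Nat.Base as ℕ using (ℕ; zero; suc; NonZero; _!)
open import Data.Nat.Properties using (_!≢0)
open import Data.Product.Base using (proj₁; proj₂)
open import Level using (Level)

-- The scalars are an arbitrary Heyting field of characteristic zero, of which
-- ℂ is an instance.  "Nonzero" means apart from 0#, which is what makes an
-- element invertible; taking _#_ to be _≉_ gives the classical notion.

CharacteristicZero : ∀ {c ℓ₁ ℓ₂ : Level} → HeytingField c ℓ₁ ℓ₂ → Set ℓ₂
CharacteristicZero F = ∀ (n : ℕ) → .{{NonZero n}} → times +-rawMonoid n 1# # 0#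
  where
  open HeytingField F using (_#_; 0#; 1#; heytingCommutativeRing)
  open CommutativeRing (HeytingCommutativeRing.commutativeRing heytingCommutativeRing)
    using (+-rawMonoid)

module PolyBernoulli
  {c ℓ₁ ℓ₂ : Level} (F : HeytingField c ℓ₁ ℓ₂) (char0 : CharacteristicZero F) where

  open HeytingField F public
  open CommutativeRing (HeytingCommutativeRing.commutativeRing heytingCommutativeRing)
    using (semiring; +-rawMonoid)
  open import Algebra.Apartness.Properties.HeytingCommutativeRing heytingCommutativeRing
    using (x-0≈x)
  open import Algebra.Properties.Semiring.Exp semiring public using (_^_)
  open import Algebra.Properties.Semiring.Mult semiring public using (_×_)
  open import Algebra.Properties.Semiring.Sum semiring public using (sum; sum-syntax)
  open import Relation.Binary.Reasoning.Setoid setoid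

  -- Σ[ a ⋯ b ] f is the sum of f m over a ≤ m ≤ b; it is empty when b < a.
  Σ[_⋯_] : ℕ → ℕ → (ℕ → Carrier) → Carrier
  Σ[ a ⋯ b ] f = ∑[ i < suc b ℕ.∸ a ] f (a ℕ.+ toℕ i)

  inverse : (x : Carrier) → x # 0# → Carrier
  inverse x x#0 = proj₁ (#⇒invertible x#0)

  *-inverseʳ : ∀ {x} (x#0 : x # 0#) → x * inverse x x#0 ≈ 1#
  *-inverseʳ {x} x#0 = trans (*-congʳ (sym (x-0≈x x))) (proj₂ (proj₂ (#⇒invertible x#0)))

  fromℕ : ℕ → Carrier
  fromℕ n = n × 1#

  recip : (n : ℕ) → .{{NonZero n}} → Carrier
  recip n = inverse (fromℕ n) (char0 n)

  power : (x : Carrier) → x # 0# → ℤ → Carrier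
  power x x#0 (+ n)    = x ^ n
  power x x#0 -[1+ n ] = inverse x x#0 ^ suc n

  fallingFactorial : Carrier → ℕ → Carrier
  fallingFactorial a zero    = 1#
  fallingFactorial a (suc j) = fallingFactorial a j * (a - fromℕ j)

  -- A formal power series is given by its coefficients: f n is that of tⁿ.

  Series : Set c
  Series = ℕ → Carrier

  infix  4 _≋_
  infixl 6 _-ˢ_
  infixl 7 _*ˢ_
  infixr 8 _^ˢ_

  _≋_ : Series → Series → Set ℓ₁
  f ≋ g = ∀ n → f n ≈ g n

  1ˢ : Series
  1ˢ zero    = 1#
  1ˢ (suc _) = 0#

  _-ˢ_ : Series → Series → Series
  (f -ˢ g) n = f n - g n

  _*ˢ_ : Series → Series → Series
  (f *ˢ g) n = Σ[ 0 ⋯ n ] λ i → f i * g (n ℕ.∸ i)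

  _^ˢ_ : Series → ℕ → Series
  f ^ˢ zero  = 1ˢ
  f ^ˢ suc m = f *ˢ f ^ˢ m

  -- Σₘ (f m) uᵐ, for u without constant term: then uᵐ does not contribute to
  -- the coefficient of tⁿ when m > n.
  _∘ˢ_ : Series → Series → Series
  (f ∘ˢ u) n = Σ[ 0 ⋯ n ] λ m → f m * (u ^ˢ m) n

  -- The series Σₙ (a n) tⁿ / n!.
  egf : (ℕ → Carrier) → Series
  egf a n = a n * recip (n !) {{n !≢0}}

  -- (1 + l t)ᵃ
  binomialSeries : Carrier → Carrier → Series
  binomialSeries l a = egf λ j → fallingFactorial a j * l ^ j

  -- Liₖ(u) / u as a series in u.
  polylogQuotient : ℤ → Series
  polylogQuotient k m = power (fromℕ (suc m)) (char0 (suc m)) (ℤ.- k)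

  module _ (l : Carrier) (l#0 : l # 0#) where

    -- 1 - (1 + l t)^(-1/l)
    argument : Series
    argument = 1ˢ -ˢ binomialSeries l (- inverse l l#0)

    generatingFunction : ℤ → Series
    generatingFunction k = polylogQuotient k ∘ˢ argument

    β : ℤ → ℕ → Carrier
    β k n = fromℕ (n !) * generatingFunction k n

    -- The condition under which _∘ˢ_ is composition of power series.
    argument-0 : argument 0 ≈ 0#
    argument-0 = begin
      1# - 1# * 1# * recip 1           ≈⟨ +-congˡ (-‿cong (*-congʳ (*-identityˡ 1#))) ⟩
      1# - 1# * recip 1                ≈⟨ +-congˡ (-‿cong (*-congʳ (+-identityʳ 1#))) ⟨
      1# - fromℕ 1 * recip 1           ≈⟨ +-congˡ (-‿cong (*-inverseʳ (char0 1))) ⟩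
      1# - 1#                          ≈⟨ -‿inverseʳ 1# ⟩
      0#                               ∎

    generatingFunction≋egf-β : ∀ k → generatingFunction k ≋ egf (β k)
    generatingFunction≋egf-β k n = sym (begin
      fromℕ (n !) * g * r   ≈⟨ *-congʳ (*-comm (fromℕ (n !)) g) ⟩
      g * fromℕ (n !) * r   ≈⟨ *-assoc g (fromℕ (n !)) r ⟩
      g * (fromℕ (n !) * r) ≈⟨ *-congˡ (*-inverseʳ (char0 (n !) {{n !≢0}})) ⟩
      g * 1#                ≈⟨ *-identityʳ g ⟩
      g                     ∎)
      where
      g = generatingFunction k n
      r = recip (n !) {{n !≢0}}

{-# OPTIONS --safe #-}

-- Put u = 1 - (1 + l t)^(-1/l), w = (1 + l t)^(1/l) - 1 and E = (1 + l t) d/dt.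
-- Since E u = (1 + l t)^(-1/l), we have w E u = u, and as E is a derivation,
-- w E uᵐ = m uᵐ.  Because (m+1)^(1-k) = (m+1)^(-k) + m (m+1)^(-k), the generating
-- functions Gₖ = Σₘ (m+1)^(-k) uᵐ satisfy Gₖ₋₁ = Gₖ + w E Gₖ.  In the coefficient
-- of tⁿ/n! the term of w E Gₖ containing β n has factor n; together with the β n
-- from Gₖ it gives (n+1) β n, and the other terms are the two sums.
module Submission where

open import Defs
open import Algebra.Apartness.Bundles using (HeytingCommutativeRing; HeytingField)
open import Algebra.Bundles using (CommutativeRing)
open import Data.Fin.Base using (toℕ)
open import Data.Integer.Base as ℤ using (ℤ; 1ℤ; +_; -[1+_])
import Data.Integer.Properties as ℤ
open import Data.Nat.Base as ℕ using (ℕ; zero; suc; _≤_; _<_; _∸_; z≤n; s≤s; NonZero; _!)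
open import Data.Nat.Combinatorics using (_C_; nCk≡nC[n∸k]; nC1≡n; k![n∸k]!∣n!)
open import Data.Nat.Combinatorics.Specification using (nCk≡n!/k![n-k]!)
open import Data.Nat.DivMod using (m/n*n≡m)
import Data.Nat.Properties as ℕ
open import Relation.Binary.PropositionalEquality as ≡ using (_≡_)

-- The factorial quotient for `_C_` is a truncated division, exact because `k ! * (n ∸ k) !` divides
-- `n !`.
nCk*k![n∸k]!≡n! : ∀ {n k} → k ≤ n → (n C k) ℕ.* (k ! ℕ.* (n ∸ k) !) ≡ n !
nCk*k![n∸k]!≡n! {n} {k} k≤n =
  ≡.trans (≡.cong (ℕ._* (k ! ℕ.* (n ∸ k) !)) (nCk≡n!/k![n-k]! k≤n))
          (m/n*n≡m (k![n∸k]!∣n! k≤n))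
  where instance _ = k ℕ.!* (n ∸ k) !≢0

module PowerSeries {c ℓ₁ ℓ₂} (F : HeytingField c ℓ₁ ℓ₂) (char0 : CharacteristicZero F) where

  open PolyBernoulli F char0
  open CommutativeRing (HeytingCommutativeRing.commutativeRing heytingCommutativeRing)
    using (semiring; commutativeSemiring; ring; +-abelianGroup)
  open import Algebra.Properties.Ring ring using (-‿distribˡ-*; -‿involutive; -1*x≈-x)
  open import Algebra.Properties.AbelianGroup +-abelianGroup using (ε⁻¹≈ε; //-rightDividesʳ)
  open import Algebra.Properties.Semiring.Mult semiring using () renaming (×1-homo-* to fromℕ-*)
  open import Algebra.Properties.Semiring.Sum semiring using (∑-distrib-+; *-distribˡ-sum)
  open import Algebra.Solver.Ring.NaturalCoefficients.Default commutativeSemiring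
    using (solve; _:=_; _:+_; _:*_; con)
  open import Relation.Binary.Reasoning.Setoid setoid

  -- Finite sums over initial segments of the naturals.

  ∑< : ℕ → (ℕ → Carrier) → Carrier
  ∑< n f = ∑[ i < n ] f (toℕ i)

  ∑<-cong : ∀ n {f g : ℕ → Carrier} → (∀ i → i < n → f i ≈ g i) → ∑< n f ≈ ∑< n g
  ∑<-cong zero    f≈g = refl
  ∑<-cong (suc n) f≈g = +-cong (f≈g 0 (s≤s z≤n)) (∑<-cong n λ i i<n → f≈g (suc i) (s≤s i<n))

  ∑<-distrib-+ : ∀ n (f g : ℕ → Carrier) → ∑< n (λ i → f i + g i) ≈ ∑< n f + ∑< n g
  ∑<-distrib-+ n f g = ∑-distrib-+ {n} (λ i → f (toℕ i)) (λ i → g (toℕ i))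

  *-distribˡ-∑< : ∀ n x (f : ℕ → Carrier) → x * ∑< n f ≈ ∑< n (λ i → x * f i)
  *-distribˡ-∑< n x f = *-distribˡ-sum {n} x (λ i → f (toℕ i))

  ∑<-last : ∀ n (f : ℕ → Carrier) → ∑< (suc n) f ≈ ∑< n f + f n
  ∑<-last zero    f = +-comm (f 0) 0#
  ∑<-last (suc n) f =
    trans (+-congˡ (∑<-last n (λ i → f (suc i)))) (sym (+-assoc _ _ _))

  -- The coefficients of a composition are sums of different lengths; this lets them all be taken up
  -- to one common bound.
  ∑<-truncate : ∀ {a b} {f : ℕ → Carrier} → a ≤ b → (∀ i → a ≤ i → f i ≈ 0#) → ∑< b f ≈ ∑< a f
  ∑<-truncate {b = zero}  z≤n f≈0 = refl
  ∑<-truncate {b = suc b} z≤n f≈0 =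
    trans (+-cong (f≈0 0 z≤n) (∑<-truncate {b = b} z≤n λ i _ → f≈0 (suc i) z≤n)) (+-identityˡ 0#)
  ∑<-truncate (s≤s a≤b) f≈0 = +-congˡ (∑<-truncate a≤b λ i a≤i → f≈0 (suc i) (s≤s a≤i))

  -- The commutative ring of formal power series.

  infixl 6 _+ˢ_
  infixr 7 _∙ˢ_

  0ˢ : Series
  0ˢ _ = 0#

  _+ˢ_ : Series → Series → Series
  (f +ˢ g) n = f n + g n

  _∙ˢ_ : Carrier → Series → Series
  (a ∙ˢ f) n = a * f n

  shift : Series → Series
  shift f n = f (suc n)

  *ˢ-cong-≤ : ∀ {f f′ g g′ : Series} n → (∀ i → i ≤ n → f i ≈ f′ i) → (∀ i → i ≤ n → g i ≈ g′ i) →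
              (f *ˢ g) n ≈ (f′ *ˢ g′) n
  *ˢ-cong-≤ n f≈f′ g≈g′ =
    ∑<-cong (suc n) λ { i (s≤s i≤n) → *-cong (f≈f′ i i≤n) (g≈g′ (n ∸ i) (ℕ.m∸n≤m n i)) }

  *ˢ-cong : ∀ {f f′ g g′ : Series} → f ≋ f′ → g ≋ g′ → f *ˢ g ≋ f′ *ˢ g′
  *ˢ-cong f≋f′ g≋g′ n = *ˢ-cong-≤ n (λ i _ → f≋f′ i) (λ i _ → g≋g′ i)

  *ˢ-congˡ : ∀ (f : Series) {g g′ : Series} → g ≋ g′ → f *ˢ g ≋ f *ˢ g′
  *ˢ-congˡ f = *ˢ-cong {f} λ _ → refl

  *ˢ-congʳ : ∀ (g : Series) {f f′ : Series} → f ≋ f′ → f *ˢ g ≋ f′ *ˢ g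
  *ˢ-congʳ g f≋f′ = *ˢ-cong {g = g} f≋f′ λ _ → refl

  -- The product unfolds by peeling off its first term. This is the mirror form, peeling off the
  -- last, which the induction for commutativity and the Leibniz rule of `∂` use.
  *ˢ-sucʳ : ∀ (f g : Series) n → (f *ˢ g) (suc n) ≈ (f *ˢ shift g) n + f (suc n) * g 0
  *ˢ-sucʳ f g n = begin
    (f *ˢ g) (suc n)
      ≈⟨ ∑<-last (suc n) (λ i → f i * g (suc n ∸ i)) ⟩
    ∑< (suc n) (λ i → f i * g (suc n ∸ i)) + f (suc n) * g (n ∸ n)
      ≈⟨ +-cong
           (∑<-cong (suc n) λ { i (s≤s i≤n) → *-congˡ {f i} (reflexive (≡.cong g (ℕ.+-∸-assoc 1 i≤n))) })
           (*-congˡ (reflexive (≡.cong g (ℕ.n∸n≡0 n)))) ⟩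
    (f *ˢ shift g) n + f (suc n) * g 0 ∎

  *ˢ-comm : ∀ (f g : Series) → f *ˢ g ≋ g *ˢ f
  *ˢ-comm f g zero    = +-congʳ (*-comm (f 0) (g 0))
  *ˢ-comm f g (suc n) = begin
    f 0 * g (suc n) + (shift f *ˢ g) n ≈⟨ +-cong (*-comm _ _) (*ˢ-comm (shift f) g n) ⟩
    g (suc n) * f 0 + (g *ˢ shift f) n ≈⟨ +-comm _ _ ⟩
    (g *ˢ shift f) n + g (suc n) * f 0 ≈⟨ *ˢ-sucʳ g f n ⟨
    (g *ˢ f) (suc n)                   ∎

  *ˢ-distribʳ : ∀ (f g h : Series) → (f +ˢ g) *ˢ h ≋ f *ˢ h +ˢ g *ˢ h
  *ˢ-distribʳ f g h n = trans
    (∑<-cong (suc n) λ i _ → distribʳ (h (n ∸ i)) (f i) (g i))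
    (∑<-distrib-+ (suc n) (λ i → f i * h (n ∸ i)) (λ i → g i * h (n ∸ i)))

  *ˢ-distribˡ : ∀ (f g h : Series) → f *ˢ (g +ˢ h) ≋ f *ˢ g +ˢ f *ˢ h
  *ˢ-distribˡ f g h n = begin
    (f *ˢ (g +ˢ h)) n         ≈⟨ *ˢ-comm f (g +ˢ h) n ⟩
    ((g +ˢ h) *ˢ f) n         ≈⟨ *ˢ-distribʳ g h f n ⟩
    (g *ˢ f) n + (h *ˢ f) n   ≈⟨ +-cong (*ˢ-comm g f n) (*ˢ-comm h f n) ⟩
    (f *ˢ g) n + (f *ˢ h) n   ∎

  ∙ˢ-*ˢ-assoc : ∀ a (f g : Series) → (a ∙ˢ f) *ˢ g ≋ a ∙ˢ (f *ˢ g)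
  ∙ˢ-*ˢ-assoc a f g n = trans
    (∑<-cong (suc n) λ i _ → *-assoc a (f i) (g (n ∸ i)))
    (sym (*-distribˡ-∑< (suc n) a (λ i → f i * g (n ∸ i))))

  *ˢ-∙ˢ-comm : ∀ a (f g : Series) → f *ˢ (a ∙ˢ g) ≋ a ∙ˢ (f *ˢ g)
  *ˢ-∙ˢ-comm a f g n = begin
    (f *ˢ (a ∙ˢ g)) n   ≈⟨ *ˢ-comm f (a ∙ˢ g) n ⟩
    ((a ∙ˢ g) *ˢ f) n   ≈⟨ ∙ˢ-*ˢ-assoc a g f n ⟩
    a * (g *ˢ f) n      ≈⟨ *-congˡ (*ˢ-comm g f n) ⟩
    a * (f *ˢ g) n      ∎

  -- Induction on the coefficient for all `f` at once. The shift of `f *ˢ g` computes to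
  -- `f 0 ∙ˢ shift g +ˢ shift f *ˢ g`; after distributivity the hypothesis is applied to `shift f`.
  *ˢ-assoc : ∀ (f g h : Series) → (f *ˢ g) *ˢ h ≋ f *ˢ (g *ˢ h)
  *ˢ-assoc f g h zero    =
    solve 3 (λ x y z → (x :* y :+ con 0) :* z :+ con 0 := x :* (y :* z :+ con 0) :+ con 0)
      refl (f 0) (g 0) (h 0)
  *ˢ-assoc f g h (suc n) = begin
    (f 0 * g 0 + 0#) * h (suc n) + ((f 0 ∙ˢ shift g +ˢ shift f *ˢ g) *ˢ h) n
      ≈⟨ +-congˡ (*ˢ-distribʳ (f 0 ∙ˢ shift g) (shift f *ˢ g) h n) ⟩
    (f 0 * g 0 + 0#) * h (suc n) + (((f 0 ∙ˢ shift g) *ˢ h) n + ((shift f *ˢ g) *ˢ h) n)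
      ≈⟨ +-congˡ (+-cong (∙ˢ-*ˢ-assoc (f 0) (shift g) h n) (*ˢ-assoc (shift f) g h n)) ⟩
    (f 0 * g 0 + 0#) * h (suc n) + (f 0 * (shift g *ˢ h) n + (shift f *ˢ (g *ˢ h)) n)
      ≈⟨ solve 5 (λ x y z s t → (x :* y :+ con 0) :* z :+ (x :* s :+ t) := x :* (y :* z :+ s) :+ t)
           refl (f 0) (g 0) (h (suc n)) ((shift g *ˢ h) n) ((shift f *ˢ (g *ˢ h)) n) ⟩
    f 0 * (g 0 * h (suc n) + (shift g *ˢ h) n) + (shift f *ˢ (g *ˢ h)) n ∎

  *ˢ-zeroˡ : ∀ (f : Series) → 0ˢ *ˢ f ≋ 0ˢ
  -- `0ˢ` is replaced by `0# ∙ˢ 0ˢ`, so that a factor `0#` can be pulled out of the product.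
  *ˢ-zeroˡ f n = trans (*ˢ-congʳ f (λ _ → sym (zeroˡ 0#)) n)
    (trans (∙ˢ-*ˢ-assoc 0# 0ˢ f n) (zeroˡ _))

  *ˢ-zeroʳ : ∀ (f : Series) → f *ˢ 0ˢ ≋ 0ˢ
  *ˢ-zeroʳ f n = trans (*ˢ-comm f 0ˢ n) (*ˢ-zeroˡ f n)

  *ˢ-identityˡ : ∀ (f : Series) → 1ˢ *ˢ f ≋ f
  *ˢ-identityˡ f zero    = trans (+-identityʳ _) (*-identityˡ (f 0))
  *ˢ-identityˡ f (suc n) =
    trans (+-cong (*-identityˡ (f (suc n))) (*ˢ-zeroˡ f n)) (+-identityʳ (f (suc n)))

  -- The only term of `w *ˢ f` at n that involves `f n` carries the factor `w 0`. This gain of one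
  -- index pays for `E` looking one coefficient ahead, and it drives `^ˢ-order`.
  *ˢ-cong-< : ∀ {w f g : Series} → w 0 ≈ 0# → ∀ n → (∀ i → i < n → f i ≈ g i) →
              (w *ˢ f) n ≈ (w *ˢ g) n
  *ˢ-cong-< {w} {f} {g} w₀≈0 zero    f≈g = +-congʳ (begin
    w 0 * f 0 ≈⟨ trans (*-congʳ w₀≈0) (zeroˡ (f 0)) ⟩
    0#        ≈⟨ trans (*-congʳ w₀≈0) (zeroˡ (g 0)) ⟨
    w 0 * g 0 ∎)
  *ˢ-cong-< {w} {f} {g} w₀≈0 (suc n) f≈g = +-cong
    (begin
      w 0 * f (suc n) ≈⟨ trans (*-congʳ w₀≈0) (zeroˡ (f (suc n))) ⟩
      0#              ≈⟨ trans (*-congʳ w₀≈0) (zeroˡ (g (suc n))) ⟨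
      w 0 * g (suc n) ∎)
    (*ˢ-cong-≤ {shift w} n (λ _ _ → refl) (λ i i≤n → f≈g i (s≤s i≤n)))

  ^ˢ-order : ∀ {u : Series} → u 0 ≈ 0# → ∀ m i → i < m → (u ^ˢ m) i ≈ 0#
  ^ˢ-order {u} u₀≈0 (suc m) i (s≤s i≤m) = trans
    -- Below index `i` the factor `u ^ˢ m` agrees with `0ˢ` by induction; its coefficients from `i`
    -- on do not enter because `u 0 ≈ 0#`.
    (*ˢ-cong-< {u} {u ^ˢ m} {0ˢ} u₀≈0 i (λ j j<i → ^ˢ-order u₀≈0 m j (ℕ.<-≤-trans j<i i≤m)))
    (*ˢ-zeroʳ u i)

  -- The derivations `θ` = t d/dt and `∂` = d/dt.

  θ : Series → Series
  θ f n = fromℕ n * f n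

  -- With f = f(0) + t h and h = `shift f`, the operator t d/dt sends t h to t (h + t dh/dt).
  θ-shift : ∀ (f : Series) → shift (θ f) ≋ shift f +ˢ θ (shift f)
  θ-shift f n = trans (distribʳ _ _ _) (+-congʳ (*-identityˡ _))

  -- The Leibniz rule by induction on the coefficient: on the part with `shift f` the weight n + 1
  -- splits as 1 + n, the n going to the hypothesis and the 1 being absorbed by `θ-shift`.
  θ-*ˢ : ∀ (f g : Series) → θ (f *ˢ g) ≋ θ f *ˢ g +ˢ f *ˢ θ g
  θ-*ˢ f g zero    =
    solve 2 (λ x y → con 0 :* (x :* y :+ con 0)
                  := con 0 :* x :* y :+ con 0 :+ (x :* (con 0 :* y) :+ con 0)) refl (f 0) (g 0)
  θ-*ˢ f g (suc n) = begin
    (1# + fromℕ n) * (f 0 * g (suc n) + (shift f *ˢ g) n)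
      ≈⟨ solve 4 (λ k x y s → (con 1 :+ k) :* (x :* y :+ s)
                           := x :* ((con 1 :+ k) :* y) :+ (s :+ k :* s))
           refl (fromℕ n) (f 0) (g (suc n)) ((shift f *ˢ g) n) ⟩
    f 0 * θ g (suc n) + ((shift f *ˢ g) n + θ (shift f *ˢ g) n)
      ≈⟨ +-congˡ (+-congˡ (θ-*ˢ (shift f) g n)) ⟩
    f 0 * θ g (suc n) + ((shift f *ˢ g) n + ((θ (shift f) *ˢ g) n + (shift f *ˢ θ g) n))
      ≈⟨ solve 6 (λ x y z s t v → x :* z :+ (s :+ (t :+ v))
                               := con 0 :* x :* y :+ (s :+ t) :+ (x :* z :+ v))
           refl (f 0) (g (suc n)) (θ g (suc n))
           ((shift f *ˢ g) n) ((θ (shift f) *ˢ g) n) ((shift f *ˢ θ g) n) ⟩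
    θ f 0 * g (suc n) + ((shift f *ˢ g) n + (θ (shift f) *ˢ g) n) + (f *ˢ θ g) (suc n)
      ≈⟨ +-congʳ (+-congˡ (trans (*ˢ-congʳ g (θ-shift f) n) (*ˢ-distribʳ (shift f) (θ (shift f)) g n))) ⟨
    (θ f *ˢ g) (suc n) + (f *ˢ θ g) (suc n) ∎

  ∂ : Series → Series
  ∂ f = shift (θ f)

  ∂-*ˢ : ∀ (f g : Series) → ∂ (f *ˢ g) ≋ ∂ f *ˢ g +ˢ f *ˢ ∂ g
  ∂-*ˢ f g n = begin
    ∂ (f *ˢ g) n
      ≈⟨ θ-*ˢ f g (suc n) ⟩
    θ f 0 * g (suc n) + (∂ f *ˢ g) n + (f *ˢ θ g) (suc n)
      ≈⟨ +-congˡ (*ˢ-sucʳ f (θ g) n) ⟩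
    θ f 0 * g (suc n) + (∂ f *ˢ g) n + ((f *ˢ ∂ g) n + f (suc n) * θ g 0)
      -- The boundary terms contain `θ f 0` and `θ g 0`, each a multiple of `fromℕ 0`.
      ≈⟨ solve 6 (λ a b c d s t → con 0 :* a :* b :+ s :+ (t :+ c :* (con 0 :* d)) := s :+ t)
           refl (f 0) (g (suc n)) (f (suc n)) (g 0) ((∂ f *ˢ g) n) ((f *ˢ ∂ g) n) ⟩
    (∂ f *ˢ g) n + (f *ˢ ∂ g) n ∎

  -- Reciprocals, factorials and integer powers.

  recip-*ˡ : ∀ n .{{_ : NonZero n}} → recip n * fromℕ n ≈ 1#
  recip-*ˡ n = trans (*-comm _ _) (*-inverseʳ (char0 n))

  fromℕ-cancelˡ : ∀ n .{{_ : NonZero n}} {x y} → fromℕ n * x ≈ y → x ≈ recip n * y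
  fromℕ-cancelˡ n {x} {y} nx≈y = begin
    x                        ≈⟨ *-identityˡ x ⟨
    1# * x                   ≈⟨ *-congʳ (recip-*ˡ n) ⟨
    recip n * fromℕ n * x    ≈⟨ *-assoc _ _ _ ⟩
    recip n * (fromℕ n * x)  ≈⟨ *-congˡ nx≈y ⟩
    recip n * y              ∎

  recip! : ℕ → Carrier
  recip! n = recip (n !) {{n ℕ.!≢0}}

  !-inverse : ∀ n → recip! n * fromℕ (n !) ≈ 1#
  !-inverse n = recip-*ˡ (n !) {{n ℕ.!≢0}}

  recip!-suc : ∀ n → fromℕ (suc n) * recip! (suc n) ≈ recip! n
  recip!-suc n = trans
    (fromℕ-cancelˡ (n !) {{n ℕ.!≢0}} (begin
      fromℕ (n !) * (fromℕ (suc n) * recip! (suc n)) ≈⟨ solve 3 (λ a b c → a :* (b :* c) := c :* (b :* a)) refl _ _ _ ⟩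
      recip! (suc n) * (fromℕ (suc n) * fromℕ (n !)) ≈⟨ *-congˡ (fromℕ-* (suc n) (n !)) ⟨
      recip! (suc n) * fromℕ (suc n !)               ≈⟨ !-inverse (suc n) ⟩
      1#                                             ∎))
    (*-identityʳ _)

  -- Multiplying a Cauchy product by n! turns it into a binomial convolution; this is the weight of
  -- its j-th term.
  fromℕ!*recip! : ∀ {n j} → j ≤ n → fromℕ (n !) * recip! (n ∸ j) ≈ fromℕ (n C j) * fromℕ (j !)
  fromℕ!*recip! {n} {j} j≤n = begin
    fromℕ (n !) * r                                 ≈⟨ *-congʳ (reflexive (≡.cong fromℕ (nCk*k![n∸k]!≡n! j≤n))) ⟨
    fromℕ ((n C j) ℕ.* (j ! ℕ.* (n ∸ j) !)) * r     ≈⟨ *-congʳ (fromℕ-* (n C j) _) ⟩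
    fromℕ (n C j) * fromℕ (j ! ℕ.* (n ∸ j) !) * r   ≈⟨ *-congʳ (*-congˡ (fromℕ-* (j !) _)) ⟩
    fromℕ (n C j) * (fromℕ (j !) * fromℕ ((n ∸ j) !)) * r
      ≈⟨ solve 4 (λ a b c d → a :* (b :* c) :* d := a :* b :* (d :* c)) refl _ _ _ _ ⟩
    fromℕ (n C j) * fromℕ (j !) * (r * fromℕ ((n ∸ j) !))
      ≈⟨ trans (*-congˡ (!-inverse (n ∸ j))) (*-identityʳ _) ⟩
    fromℕ (n C j) * fromℕ (j !) ∎
    where r = recip! (n ∸ j)

  power-suc : ∀ x (x#0 : x # 0#) j → power x x#0 (1ℤ ℤ.+ j) ≈ x * power x x#0 j
  power-suc x x#0 (+ n)          = refl
  power-suc x x#0 -[1+ zero ]    =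
    sym (trans (*-congˡ (*-identityʳ _)) (*-inverseʳ x#0))
  power-suc x x#0 -[1+ suc n ]   = sym (begin
    x * (inverse x x#0 * (inverse x x#0 ^ suc n)) ≈⟨ *-assoc _ _ _ ⟨
    x * inverse x x#0 * (inverse x x#0 ^ suc n)   ≈⟨ *-congʳ (*-inverseʳ x#0) ⟩
    1# * (inverse x x#0 ^ suc n)                  ≈⟨ *-identityˡ _ ⟩
    inverse x x#0 ^ suc n                         ∎)

  polylogQuotient-pred : ∀ k m → polylogQuotient (k ℤ.- 1ℤ) m ≈ fromℕ (suc m) * polylogQuotient k m
  polylogQuotient-pred k m = trans
    (reflexive (≡.cong (power (fromℕ (suc m)) (char0 (suc m)))
      (≡.trans (ℤ.neg-distrib-+ k -[1+ 0 ]) (ℤ.+-comm (ℤ.- k) 1ℤ))))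
    (power-suc (fromℕ (suc m)) (char0 (suc m)) (ℤ.- k))

  -- A linear combination with a bound fixed in advance, whereas in `_∘ˢ_` the bound grows with the
  -- coefficient. The fixed bound makes linearity of `E` applicable.
  ∑ˢ : ℕ → (ℕ → Carrier) → (ℕ → Series) → Series
  ∑ˢ N a g n = ∑< N λ m → a m * g m n

  -- The derivation `E` and its effect on compositions.

  module Euler (l : Carrier) where

    -- (1 + l t) d/dt
    E : Series → Series
    E f = ∂ f +ˢ l ∙ˢ θ f

    E-cong-≤ : ∀ {f g : Series} n → (∀ i → i ≤ suc n → f i ≈ g i) → E f n ≈ E g n
    E-cong-≤ n f≈g =
      +-cong (*-congˡ (f≈g (suc n) ℕ.≤-refl)) (*-congˡ (*-congˡ (f≈g n (ℕ.n≤1+n n))))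

    E-linear : ∀ a (f g : Series) → E (a ∙ˢ f +ˢ g) ≋ a ∙ˢ E f +ˢ E g
    E-linear a f g n =
      solve 8 (λ k k′ l a x x′ y y′ → k′ :* (a :* x′ :+ y′) :+ l :* (k :* (a :* x :+ y))
                := a :* (k′ :* x′ :+ l :* (k :* x)) :+ (k′ :* y′ :+ l :* (k :* y)))
        refl (fromℕ n) (fromℕ (suc n)) l a (f n) (f (suc n)) (g n) (g (suc n))

    E-0ˢ : E 0ˢ ≋ 0ˢ
    E-0ˢ n = solve 3 (λ k k′ l → k′ :* con 0 :+ l :* (k :* con 0) := con 0)
      refl (fromℕ n) (fromℕ (suc n)) l

    E-1ˢ : E 1ˢ ≋ 0ˢ
    E-1ˢ zero    = solve 2 (λ k l → k :* con 0 :+ l :* (con 0 :* con 1) := con 0) refl _ l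
    E-1ˢ (suc n) = E-0ˢ (suc n)

    E-*ˢ : ∀ (f g : Series) → E (f *ˢ g) ≋ E f *ˢ g +ˢ f *ˢ E g
    E-*ˢ f g n = begin
      ∂ (f *ˢ g) n + l * θ (f *ˢ g) n
        ≈⟨ +-cong (∂-*ˢ f g n) (*-congˡ (θ-*ˢ f g n)) ⟩
      (∂ f *ˢ g) n + (f *ˢ ∂ g) n + l * ((θ f *ˢ g) n + (f *ˢ θ g) n)
        ≈⟨ solve 5 (λ x y l s t → x :+ y :+ l :* (s :+ t) := (x :+ l :* s) :+ (y :+ l :* t))
             refl ((∂ f *ˢ g) n) ((f *ˢ ∂ g) n) l ((θ f *ˢ g) n) ((f *ˢ θ g) n) ⟩
      ((∂ f *ˢ g) n + l * (θ f *ˢ g) n) + ((f *ˢ ∂ g) n + l * (f *ˢ θ g) n)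
        ≈⟨ +-cong (+-congˡ (∙ˢ-*ˢ-assoc l (θ f) g n)) (+-congˡ (*ˢ-∙ˢ-comm l f (θ g) n)) ⟨
      ((∂ f *ˢ g) n + ((l ∙ˢ θ f) *ˢ g) n) + ((f *ˢ ∂ g) n + (f *ˢ (l ∙ˢ θ g)) n)
        ≈⟨ +-cong (*ˢ-distribʳ (∂ f) (l ∙ˢ θ f) g n) (*ˢ-distribˡ f (∂ g) (l ∙ˢ θ g) n) ⟨
      (E f *ˢ g) n + (f *ˢ E g) n ∎

    -- Vanishing of `E f` reads (n+1) f(n+1) = - l n f(n). At n = 0 the right side is zero whatever
    -- `f 0` is, and the zeros propagate upwards because n+1 is invertible. So a series killed by
    -- `E` is determined by its constant term.
    E-kernel : ∀ {f : Series} → E f ≋ 0ˢ → ∀ n → f (suc n) ≈ 0#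
    E-kernel {f} Ef≋0 n = trans (fromℕ-cancelˡ (suc n) (begin
      ∂ f n               ≈⟨ +-identityʳ _ ⟨
      ∂ f n + 0#          ≈⟨ +-congˡ (trans (*-congˡ (θf≈0 n)) (zeroʳ l)) ⟨
      ∂ f n + l * θ f n   ≈⟨ Ef≋0 n ⟩
      0#                  ∎)) (zeroʳ _)
      where
      θf≈0 : ∀ m → θ f m ≈ 0#
      θf≈0 zero    = zeroˡ (f 0)
      θf≈0 (suc m) = trans (*-congˡ (E-kernel Ef≋0 m)) (zeroʳ _)

    w*E-∑ˢ : ∀ (w : Series) N a g → w *ˢ E (∑ˢ N a g) ≋ ∑ˢ N a (λ m → w *ˢ E (g m))
    w*E-∑ˢ w zero    a g n = trans (*ˢ-congˡ w E-0ˢ n) (*ˢ-zeroʳ w n)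
    w*E-∑ˢ w (suc N) a g n = begin
      (w *ˢ E (a 0 ∙ˢ g 0 +ˢ rest)) n
        ≈⟨ *ˢ-congˡ w (E-linear (a 0) (g 0) rest) n ⟩
      (w *ˢ (a 0 ∙ˢ E (g 0) +ˢ E rest)) n
        ≈⟨ *ˢ-distribˡ w (a 0 ∙ˢ E (g 0)) (E rest) n ⟩
      (w *ˢ (a 0 ∙ˢ E (g 0))) n + (w *ˢ E rest) n
        ≈⟨ +-cong (*ˢ-∙ˢ-comm (a 0) w (E (g 0)) n)
                  (w*E-∑ˢ w N (λ m → a (suc m)) (λ m → g (suc m)) n) ⟩
      a 0 * (w *ˢ E (g 0)) n + ∑ˢ N (λ m → a (suc m)) (λ m → w *ˢ E (g (suc m))) n ∎
      where rest = ∑ˢ N (λ m → a (suc m)) (λ m → g (suc m))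

    module _ {w u : Series} (w*Eu≋u : w *ˢ E u ≋ u) where

      -- With v the previous power, w E(u v) = (w E u) v + u (w E v); the first summand is one copy
      -- of u v, the second m copies.
      w*E-^ˢ : ∀ m → w *ˢ E (u ^ˢ m) ≋ fromℕ m ∙ˢ (u ^ˢ m)
      w*E-^ˢ zero    n = trans (*ˢ-congˡ w E-1ˢ n) (trans (*ˢ-zeroʳ w n) (sym (zeroˡ _)))
      w*E-^ˢ (suc m) n = begin
        (w *ˢ E (u *ˢ v)) n
          ≈⟨ *ˢ-congˡ w (E-*ˢ u v) n ⟩
        (w *ˢ (E u *ˢ v +ˢ u *ˢ E v)) n
          ≈⟨ *ˢ-distribˡ w (E u *ˢ v) (u *ˢ E v) n ⟩
        (w *ˢ (E u *ˢ v)) n + (w *ˢ (u *ˢ E v)) n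
          ≈⟨ +-cong (*ˢ-assoc w (E u) v n) (*ˢ-assoc w u (E v) n) ⟨
        ((w *ˢ E u) *ˢ v) n + ((w *ˢ u) *ˢ E v) n
          ≈⟨ +-cong (*ˢ-congʳ v w*Eu≋u n) (*ˢ-congʳ (E v) (*ˢ-comm w u) n) ⟩
        (u *ˢ v) n + ((u *ˢ w) *ˢ E v) n
          ≈⟨ +-congˡ (*ˢ-assoc u w (E v) n) ⟩
        (u *ˢ v) n + (u *ˢ (w *ˢ E v)) n
          ≈⟨ +-congˡ (*ˢ-congˡ u (w*E-^ˢ m) n) ⟩
        (u *ˢ v) n + (u *ˢ (fromℕ m ∙ˢ v)) n
          ≈⟨ +-congˡ (*ˢ-∙ˢ-comm (fromℕ m) u v n) ⟩
        (u *ˢ v) n + fromℕ m * (u *ˢ v) n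
          ≈⟨ solve 2 (λ k x → x :+ k :* x := (con 1 :+ k) :* x) refl (fromℕ m) ((u *ˢ v) n) ⟩
        (1# + fromℕ m) * (u *ˢ v) n ∎
        where v = u ^ˢ m

      w*E-∘ˢ : w 0 ≈ 0# → u 0 ≈ 0# → ∀ f → w *ˢ E (f ∘ˢ u) ≋ θ f ∘ˢ u
      w*E-∘ˢ w₀≈0 u₀≈0 f n = begin
        (w *ˢ E (f ∘ˢ u)) n
          -- Coefficient n of the product involves `E (f ∘ˢ u)` only below n, since `w 0 ≈ 0#`,
          -- hence `f ∘ˢ u` only up to n, where truncation after the n-th power of `u` is exact.
          ≈⟨ *ˢ-cong-< {w} w₀≈0 n (λ i i<n → E-cong-≤ i λ j j≤1+i →
               truncated j (ℕ.≤-trans j≤1+i i<n)) ⟩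
        (w *ˢ E (∑ˢ (suc n) f (u ^ˢ_))) n
          ≈⟨ w*E-∑ˢ w (suc n) f (u ^ˢ_) n ⟩
        ∑< (suc n) (λ m → f m * (w *ˢ E (u ^ˢ m)) n)
          ≈⟨ ∑<-cong (suc n) (λ m _ → trans (*-congˡ (w*E-^ˢ m n))
               (solve 3 (λ x k y → x :* (k :* y) := k :* x :* y) refl (f m) (fromℕ m) ((u ^ˢ m) n))) ⟩
        (θ f ∘ˢ u) n ∎
        where
        truncated : ∀ j → j ≤ n → (f ∘ˢ u) j ≈ ∑ˢ (suc n) f (u ^ˢ_) j
        truncated j j≤n = sym (∑<-truncate (s≤s j≤n) λ m j<m →
          trans (*-congˡ (^ˢ-order {u} u₀≈0 m j j<m)) (zeroʳ (f m)))

    -- Binomial series as eigenvectors of `E`.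

    E-binomialSeries : ∀ a → E (binomialSeries l a) ≋ (a * l) ∙ˢ binomialSeries l a
    E-binomialSeries a n = begin
      fromℕ (suc n) * (ff * (a - k) * (l * l ^ n) * recip! (suc n)) + l * (k * (ff * (l ^ n) * recip! n))
        ≈⟨ solve 8 (λ k k′ p d l q r r′ →
                      k′ :* (p :* d :* (l :* q) :* r′) :+ l :* (k :* (p :* q :* r))
                   := p :* d :* (l :* q) :* (k′ :* r′) :+ l :* (k :* (p :* q :* r)))
             refl k (fromℕ (suc n)) ff (a - k) l (l ^ n) (recip! n) (recip! (suc n)) ⟩
      ff * (a - k) * (l * l ^ n) * (fromℕ (suc n) * recip! (suc n)) + l * (k * (ff * (l ^ n) * recip! n))
        ≈⟨ +-congʳ (*-congˡ (recip!-suc n)) ⟩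
      ff * (a - k) * (l * l ^ n) * recip! n + l * (k * (ff * (l ^ n) * recip! n))
        ≈⟨ solve 6 (λ k p d l q r → p :* d :* (l :* q) :* r :+ l :* (k :* (p :* q :* r))
                                 := (d :+ k) :* l :* (p :* q :* r))
             refl k ff (a - k) l (l ^ n) (recip! n) ⟩
      -- The next falling factorial contributes `a - k`, the part `l ∙ˢ θ` of `E` contributes `k`;
      -- their sum `a` no longer depends on n.
      (a - k + k) * l * (ff * (l ^ n) * recip! n)
        ≈⟨ *-congʳ (*-congʳ (trans (+-assoc _ _ _) (trans (+-congˡ (-‿inverseˡ k)) (+-identityʳ a)))) ⟩
      a * l * (ff * (l ^ n) * recip! n) ∎
      where
      k = fromℕ n
      ff = fallingFactorial a n

    binomialSeries-0 : ∀ a → binomialSeries l a 0 ≈ 1#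
    binomialSeries-0 a = begin
      1# * 1# * recip! 0      ≈⟨ solve 1 (λ r → con 1 :* con 1 :* r := r :* (con 1 :+ con 0)) refl (recip! 0) ⟩
      recip! 0 * fromℕ (0 !)  ≈⟨ !-inverse 0 ⟩
      1#                      ∎

    -- The eigenvalues `a * l` and `- a * l` of the factors add up to zero, so `E` kills the
    -- product. By `E-kernel` only its constant term survives, which is 1.
    binomialSeries-inverse : ∀ a → binomialSeries l a *ˢ binomialSeries l (- a) ≋ 1ˢ
    binomialSeries-inverse a zero    = begin
      binomialSeries l a 0 * binomialSeries l (- a) 0 + 0#
        ≈⟨ +-congʳ (*-cong (binomialSeries-0 a) (binomialSeries-0 (- a))) ⟩
      1# * 1# + 0#
        ≈⟨ trans (+-identityʳ _) (*-identityˡ _) ⟩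
      1# ∎
    binomialSeries-inverse a (suc n) = E-kernel (λ m → begin
      E (B *ˢ B⁻) m
        ≈⟨ E-*ˢ B B⁻ m ⟩
      (E B *ˢ B⁻) m + (B *ˢ E B⁻) m
        ≈⟨ +-cong (*ˢ-congʳ B⁻ (E-binomialSeries a) m) (*ˢ-congˡ B (E-binomialSeries (- a)) m) ⟩
      (((a * l) ∙ˢ B) *ˢ B⁻) m + (B *ˢ ((- a * l) ∙ˢ B⁻)) m
        ≈⟨ +-cong (∙ˢ-*ˢ-assoc (a * l) B B⁻ m) (*ˢ-∙ˢ-comm (- a * l) B B⁻ m) ⟩
      a * l * (B *ˢ B⁻) m + - a * l * (B *ˢ B⁻) m
        ≈⟨ solve 4 (λ a b l h → a :* l :* h :+ b :* l :* h := (a :+ b) :* (l :* h)) refl a (- a) l ((B *ˢ B⁻) m) ⟩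
      (a - a) * (l * (B *ˢ B⁻) m)
        ≈⟨ trans (*-congʳ (-‿inverseʳ a)) (zeroˡ _) ⟩
      0# ∎) n
      where
      B = binomialSeries l a
      B⁻ = binomialSeries l (- a)

  -- The relation between the generating functions for k - 1 and k.

  module DegeneratePolyBernoulli (l : Carrier) (l#0 : l # 0#) where

    open Euler l

    1/l : Carrier
    1/l = inverse l l#0

    -- `e` and `b` are (1 + l t) to the powers 1/l and -1/l, hence mutually inverse; `e-1` takes the
    -- role of `w` in `Euler`.
    u b e e-1 : Series
    u = argument l l#0
    b = binomialSeries l (- 1/l)
    e = binomialSeries l 1/l
    e-1 = e -ˢ 1ˢ

    E-argument : E u ≋ b
    E-argument n = begin
      E u n
        ≈⟨ E-cong-≤ n (λ i _ →
             trans (+-comm (1ˢ i) _) (+-congʳ (sym (-1*x≈-x (b i))))) ⟩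
      -- `u` is put in the shape required by `E-linear`. The factor `- 1#` will cancel against the
      -- eigenvalue `- 1/l * l` of `b`.
      E (- 1# ∙ˢ b +ˢ 1ˢ) n
        ≈⟨ E-linear (- 1#) b 1ˢ n ⟩
      - 1# * E b n + E 1ˢ n
        ≈⟨ +-cong (*-congˡ (E-binomialSeries (- 1/l) n)) (E-1ˢ n) ⟩
      - 1# * (- 1/l * l * b n) + 0#
        ≈⟨ trans (+-identityʳ _) (-1*x≈-x _) ⟩
      - (- 1/l * l * b n)
        ≈⟨ -‿cong (trans (*-congʳ (trans (sym (-‿distribˡ-* 1/l l)) (-‿cong 1/l*l≈1))) (-1*x≈-x (b n))) ⟩
      - (- b n)
        ≈⟨ -‿involutive (b n) ⟩
      b n ∎
      where
      1/l*l≈1 : 1/l * l ≈ 1#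
      1/l*l≈1 = trans (*-comm 1/l l) (*-inverseʳ l#0)

    -- By `E-argument` the left side is (e - 1) b = e b - b = 1 - b, as `e` and `b` are inverse.
    e-1*E-argument : e-1 *ˢ E u ≋ u
    e-1*E-argument n = begin
      (e-1 *ˢ E u) n
        ≈⟨ *ˢ-cong (λ i → +-congˡ {e i} (sym (-1*x≈-x (1ˢ i)))) E-argument n ⟩
      ((e +ˢ - 1# ∙ˢ 1ˢ) *ˢ b) n
        ≈⟨ *ˢ-distribʳ e (- 1# ∙ˢ 1ˢ) b n ⟩
      (e *ˢ b) n + ((- 1# ∙ˢ 1ˢ) *ˢ b) n
        ≈⟨ +-cong (binomialSeries-inverse 1/l n) (∙ˢ-*ˢ-assoc (- 1#) 1ˢ b n) ⟩
      1ˢ n + - 1# * (1ˢ *ˢ b) n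
        ≈⟨ +-congˡ (trans (-1*x≈-x _) (-‿cong (*ˢ-identityˡ b n))) ⟩
      u n ∎

    e-1-0 : e-1 0 ≈ 0#
    e-1-0 = trans (+-congʳ (binomialSeries-0 1/l)) (-‿inverseʳ 1#)

    G : ℤ → Series
    G = generatingFunction l l#0

    G-pred : ∀ k → G (k ℤ.- 1ℤ) ≋ G k +ˢ E (G k) *ˢ e-1
    G-pred k n = begin
      ∑< (suc n) (λ m → polylogQuotient (k ℤ.- 1ℤ) m * (u ^ˢ m) n)
        ≈⟨ ∑<-cong (suc n) (λ m _ → trans (*-congʳ (polylogQuotient-pred k m))
             (solve 3 (λ j p x → (con 1 :+ j) :* p :* x := p :* x :+ j :* p :* x)
               refl (fromℕ m) (polylogQuotient k m) ((u ^ˢ m) n))) ⟩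
      ∑< (suc n) (λ m → polylogQuotient k m * (u ^ˢ m) n + θ (polylogQuotient k) m * (u ^ˢ m) n)
        ≈⟨ ∑<-distrib-+ (suc n) (λ m → polylogQuotient k m * (u ^ˢ m) n)
             (λ m → θ (polylogQuotient k) m * (u ^ˢ m) n) ⟩
      G k n + (θ (polylogQuotient k) ∘ˢ u) n
        ≈⟨ +-congˡ (w*E-∘ˢ {e-1} {u} e-1*E-argument e-1-0 (argument-0 l l#0) (polylogQuotient k) n) ⟨
      G k n + (e-1 *ˢ E (G k)) n
        -- The factors are swapped so that the summation index of the product runs over the
        -- coefficients of `E (G k)`, and thus over the `β`.
        ≈⟨ +-congˡ (*ˢ-comm e-1 (E (G k)) n) ⟩
      G k n + (E (G k) *ˢ e-1) n ∎

    -- Comparison of the coefficients of t^n/n! and the recurrence.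

    e-1-suc : ∀ n → e-1 (suc n) ≈ e (suc n)
    e-1-suc n = trans (+-congˡ ε⁻¹≈ε) (+-identityʳ _)

    -- The exponential coefficients of (1 + l t)^(1/l): `e` unfolds to `egf φ`.
    φ : ℕ → Carrier
    φ j = fallingFactorial 1/l j * l ^ j

    module _ (k : ℤ) where

      X : ℕ → Carrier
      X = β l l#0 k

      -- On exponential coefficients d/dt is a shift of the index.
      X-suc : ∀ j → fromℕ (j !) * ∂ (G k) j ≈ X (suc j)
      X-suc j = begin
        fromℕ (j !) * (fromℕ (suc j) * G k (suc j))
          ≈⟨ solve 3 (λ a b c → a :* (b :* c) := b :* a :* c) refl _ _ _ ⟩
        fromℕ (suc j) * fromℕ (j !) * G k (suc j)
          ≈⟨ *-congʳ (fromℕ-* (suc j) (j !)) ⟨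
        X (suc j) ∎

      -- The summands come from the two parts `∂` and `l ∙ˢ θ` of `E`: the first raises the index of
      -- `X`, the second brings the factor j. Since j < n, the factor `e-1` is evaluated off its
      -- constant term, where it agrees with `e`.
      term : ∀ {n j} → j < n → fromℕ (n !) * (E (G k) j * e-1 (n ∸ j)) ≈
             fromℕ (n C j) * X (suc j) * φ (n ∸ j)
               + l * (fromℕ (n C j) * fallingFactorial 1/l (n ∸ j) * l ^ (n ∸ j) * fromℕ j * X j)
      term {n} {j} j<n = begin
        fromℕ (n !) * (E (G k) j * e-1 (n ∸ j))
          ≈⟨ *-congˡ (*-congˡ e-1≈e) ⟩
        fromℕ (n !) * (E (G k) j * (φ (n ∸ j) * recip! (n ∸ j)))
          ≈⟨ solve 4 (λ a b c d → a :* (b :* (c :* d)) := a :* d :* (b :* c)) refl _ _ _ _ ⟩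
        fromℕ (n !) * recip! (n ∸ j) * (E (G k) j * φ (n ∸ j))
          ≈⟨ *-congʳ (fromℕ!*recip! (ℕ.<⇒≤ j<n)) ⟩
        fromℕ (n C j) * fromℕ (j !) * ((∂ (G k) j + l * (fromℕ j * G k j)) * φ (n ∸ j))
          ≈⟨ solve 8 (λ c i x l j g p q → c :* i :* ((x :+ l :* (j :* g)) :* (p :* q))
                       := c :* (i :* x) :* (p :* q) :+ l :* (c :* p :* q :* j :* (i :* g)))
               refl (fromℕ (n C j)) (fromℕ (j !)) (∂ (G k) j) l (fromℕ j) (G k j)
               (fallingFactorial 1/l (n ∸ j)) (l ^ (n ∸ j)) ⟩
        fromℕ (n C j) * (fromℕ (j !) * ∂ (G k) j) * φ (n ∸ j) + _
          ≈⟨ +-congʳ (*-congʳ (*-congˡ (X-suc j))) ⟩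
        fromℕ (n C j) * X (suc j) * φ (n ∸ j) + _ ∎
        where
        e-1≈e : e-1 (n ∸ j) ≈ e (n ∸ j)
        e-1≈e with n ∸ j | ℕ.m<n⇒0<n∸m j<n
        ... | suc i | _ = e-1-suc i

      -- Spelled as in the theorem, so that `recurrence` yields it by computation.
      S₁ S₂ : ℕ → Carrier
      S₁ n = Σ[ 1 ⋯ n ∸ 1 ] λ m →
        fromℕ (n C (m ∸ 1)) * X m * fallingFactorial 1/l (n ∸ m ℕ.+ 1) * l ^ (n ∸ m ℕ.+ 1)
      S₂ n = Σ[ 0 ⋯ n ∸ 1 ] λ m →
        fromℕ (n C m) * fallingFactorial 1/l (n ∸ m) * l ^ (n ∸ m) * fromℕ m * X m

      -- With n = `suc p`, the term j = p, that is m = n, is split off: its binomial coefficient is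
      -- n and `φ 1` is 1, which gives n copies of `X n`.
      first-sum : ∀ p → ∑< (suc p) (λ j → fromℕ (suc p C j) * X (suc j) * φ (suc p ∸ j)) ≈
                  S₁ (suc p) + fromℕ (suc p) * X (suc p)
      first-sum p = trans (∑<-last p (λ j → fromℕ (suc p C j) * X (suc j) * φ (suc p ∸ j))) (+-cong
        -- At m = `suc j` the index `n ∸ m + 1` computes to `p ∸ j + 1`, which equals `suc p ∸ j`
        -- because j ≤ p.
        (∑<-cong p λ j j<p → trans (sym (*-assoc _ _ _))
          (reflexive (≡.cong (λ i → fromℕ (suc p C j) * X (suc j) * fallingFactorial 1/l i * l ^ i)
            (≡.trans (ℕ.+-∸-assoc 1 (ℕ.<⇒≤ j<p)) (ℕ.+-comm 1 (p ∸ j))))))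
        (begin
          fromℕ (suc p C p) * X (suc p) * φ (suc p ∸ p)
            ≈⟨ *-cong (*-congʳ (reflexive (≡.cong fromℕ [1+p]Cp≡1+p))) (reflexive (≡.cong φ (ℕ.m+n∸n≡m 1 p))) ⟩
          fromℕ (suc p) * X (suc p) * φ 1
            ≈⟨ trans (*-congˡ φ-1) (*-identityʳ _) ⟩
          fromℕ (suc p) * X (suc p) ∎))
        where
        [1+p]Cp≡1+p : suc p C p ≡ suc p
        [1+p]Cp≡1+p = ≡.trans (nCk≡nC[n∸k] (ℕ.n≤1+n p))
          (≡.trans (≡.cong (suc p C_) (ℕ.m+n∸n≡m 1 p)) (nC1≡n (suc p)))
        φ-1 : φ 1 ≈ 1#
        φ-1 = begin
          1# * (1/l - 0#) * (l * 1#) ≈⟨ *-congʳ (*-congˡ (trans (+-congˡ ε⁻¹≈ε) (+-identityʳ 1/l))) ⟩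
          1# * 1/l * (l * 1#)        ≈⟨ solve 2 (λ x y → con 1 :* x :* (y :* con 1) := y :* x) refl 1/l l ⟩
          l * 1/l                    ≈⟨ *-inverseʳ l#0 ⟩
          1#                         ∎

      product-coefficient : ∀ p → fromℕ (suc p !) * (E (G k) *ˢ e-1) (suc p) ≈
                            S₁ (suc p) + fromℕ (suc p) * X (suc p) + l * S₂ (suc p)
      product-coefficient p = begin
        fromℕ (n !) * ∑< (suc n) t
          ≈⟨ *-congˡ (∑<-last n t) ⟩
        fromℕ (n !) * (∑< n t + E (G k) n * e-1 (n ∸ n))
          -- The term j = n is the only one that would involve `X (suc n)`; it vanishes because
          -- `e-1` has no constant term.
          ≈⟨ *-congˡ (trans (+-congˡ (trans (*-congˡ e-1[n∸n]≈0) (zeroʳ _))) (+-identityʳ _)) ⟩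
        fromℕ (n !) * ∑< n t
          ≈⟨ *-distribˡ-∑< n (fromℕ (n !)) t ⟩
        ∑< n (λ j → fromℕ (n !) * t j)
          ≈⟨ ∑<-cong n (λ j → term) ⟩
        ∑< n (λ j → s₁ j + l * s₂ j)
          ≈⟨ ∑<-distrib-+ n s₁ (λ j → l * s₂ j) ⟩
        ∑< n s₁ + ∑< n (λ j → l * s₂ j)
          ≈⟨ +-cong (first-sum p) (sym (*-distribˡ-∑< n l s₂)) ⟩
        S₁ n + fromℕ n * X n + l * S₂ n ∎
        where
        n = suc p
        t s₁ s₂ : ℕ → Carrier
        t j = E (G k) j * e-1 (n ∸ j)
        s₁ j = fromℕ (n C j) * X (suc j) * φ (n ∸ j)
        s₂ j = fromℕ (n C j) * fallingFactorial 1/l (n ∸ j) * l ^ (n ∸ j) * fromℕ j * X j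
        e-1[n∸n]≈0 : e-1 (n ∸ n) ≈ 0#
        e-1[n∸n]≈0 = trans (reflexive (≡.cong e-1 (ℕ.n∸n≡0 n))) e-1-0

      β-pred : ∀ p → β l l#0 (k ℤ.- 1ℤ) (suc p) ≈
               fromℕ (suc (suc p)) * X (suc p) + l * S₂ (suc p) + S₁ (suc p)
      β-pred p = begin
        fromℕ (n !) * G (k ℤ.- 1ℤ) n
          ≈⟨ *-congˡ (G-pred k n) ⟩
        fromℕ (n !) * (G k n + (E (G k) *ˢ e-1) n)
          ≈⟨ distribˡ _ _ _ ⟩
        X n + fromℕ (n !) * (E (G k) *ˢ e-1) n
          ≈⟨ +-congˡ (product-coefficient p) ⟩
        X n + (S₁ n + fromℕ n * X n + l * S₂ n)
          -- `S₁` is moved to the end, so that the subtractions in `recurrence` cancel from the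
          -- right in their order.
          ≈⟨ solve 4 (λ x s m t → x :+ (s :+ m :* x :+ t) := (con 1 :+ m) :* x :+ t :+ s)
               refl (X n) (S₁ n) (fromℕ n) (l * S₂ n) ⟩
        fromℕ (suc n) * X n + l * S₂ n + S₁ n ∎
        where n = suc p

      recurrence : ∀ p → X (suc p) ≈ recip (suc (suc p)) *
                   (β l l#0 (k ℤ.- 1ℤ) (suc p) - S₁ (suc p) - l * S₂ (suc p))
      recurrence p = fromℕ-cancelˡ (suc (suc p)) (sym (begin
        β l l#0 (k ℤ.- 1ℤ) n - S₁ n - l * S₂ n
          ≈⟨ +-congʳ (+-congʳ (β-pred p)) ⟩
        fromℕ (suc n) * X n + l * S₂ n + S₁ n - S₁ n - l * S₂ n
          ≈⟨ +-congʳ (//-rightDividesʳ (S₁ n) _) ⟩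
        fromℕ (suc n) * X n + l * S₂ n - l * S₂ n
          ≈⟨ //-rightDividesʳ (l * S₂ n) _ ⟩
        fromℕ (suc n) * X n ∎))
        where n = suc p

theorem5 : ∀ {c ℓ₁ ℓ₂} (F : HeytingField c ℓ₁ ℓ₂) (char0 : CharacteristicZero F) →
    let open PolyBernoulli F char0 in
    (k : ℤ) (n : ℕ) → 1 ≤ n → (l : Carrier) (l#0 : l # 0#) →
    let 1/l = inverse l l#0 in
    β l l#0 k n ≈
      recip (suc n) *
        ( β l l#0 (k ℤ.- 1ℤ) n
        - (Σ[ 1 ⋯ n ∸ 1 ] λ m →
            fromℕ (n C (m ∸ 1)) * β l l#0 k m
              * fallingFactorial 1/l (n ∸ m ℕ.+ 1) * l ^ (n ∸ m ℕ.+ 1))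
        - l * (Σ[ 0 ⋯ n ∸ 1 ] λ m →
            fromℕ (n C m) * fallingFactorial 1/l (n ∸ m) * l ^ (n ∸ m)
              * fromℕ m * β l l#0 k m))
-- The bound `1 ≤ n` excludes zero, and at `suc p` the truncated `n ∸ 1` computes to `p`.
theorem5 F char0 k (suc p) _ l l#0 =
  PowerSeries.DegeneratePolyBernoulli.recurrence F char0 l l#0 k p
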